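{- For all processes $p,q$: 1. $p\sqsubseteq_{\mathcal{L}'_{\leq_I^{l\supseteq\wedge f}}}q$ if and only if $LGO_I(p)\leq_I^{l\supseteq\wedge f}LGO_I(q)$; 2. $p\sqsubseteq_{\mathcal{L}'_{\leq_I^{l\supseteq\vee f}}}q$ if and only if $LGO_I(p)\leq_I^{l\supseteq\vee f}LGO_I(q)$.
   Context: Processes are states of a labelled transition system with action set $Act$ and transitions $p\xrightarrow{a}p'$; $I(p)=\{a\in Act\mid p\xrightarrow{a}\}$. Hennessy-Milner formulas: $\varphi::=\bigwedge_{i\in I}\varphi_i\mid a\varphi\mid\neg\varphi$ (arbitrary index sets), where $p\models a\varphi$ iff $p\xrightarrow{a}q$ and $q\models\varphi$ for some $q$, and conjunction and negation have their usual meaning. $\top$ is the empty conjunction and $0$ abbreviates $\bigwedge_{a\in Act}\neg a\top$. For a set of formulas $\mathcal{L}$: $p\sqsubseteq_{\mathcal{L}}q$ iff for all $\varphi\in\mathcal{L}$, $p\models\varphi$ implies $q\models\varphi$. Let $\mathcal{L}'_I=\{\top,\neg 0\}\cup\{a\top\mid a\in Act\}$. $\mathcal{L}_I^{\equiv}$ is the least set containing $\sigma$ and $\neg\sigma$ for $\sigma\in\mathcal{L}'_I$ and closed under arbitrary conjunctions. $\mathcal{L}_I^{\neg}$ is the least set containing $\neg\sigma$ for $\sigma\in\mathcal{L}'_I$ and closed under arbitrary conjunctions. $\mathcal{L}'_{\leq_I^{l\supseteq\wedge f}}$ is the least set $\mathcal{M}$ with: $\top\in\mathcal{M}$; $\varphi\in\mathcal{M},\sigma\in\mathcal{L}_I^{\neg}\Rightarrow\sigma\wedge\varphi\in\mathcal{M}$;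 $\sigma\in\mathcal{L}_I^{\equiv}\Rightarrow\sigma\in\mathcal{M}$; $\varphi\in\mathcal{M},a\in Act\Rightarrow a\varphi\in\mathcal{M}$. $\mathcal{L}'_{\leq_I^{l\supseteq\vee f}}$ is the least set $\mathcal{M}$ with: $\top\in\mathcal{M}$; if $\sigma\in\mathcal{L}'_I$ and $\sigma_j\in\mathcal{L}'_I$ for all $j\in J$ ($J$ any index set), then $\sigma\wedge\bigwedge_{j\in J}\neg\sigma_j\in\mathcal{M}$; $\varphi\in\mathcal{M},a\in Act\Rightarrow a\varphi\in\mathcal{M}$. $LGO_I(p)$ is the set of sequences $X_0a_1X_1\ldots a_nX_n$ ($n\ge0$) such that there are transitions $p=p_0\xrightarrow{a_1}p_1\cdots\xrightarrow{a_n}p_n$ with $X_i=I(p_i)$ for all $i$. For sets $\zeta,\zeta'$ of such sequences: - $\zeta\leq_I^{l\supseteq\wedge f}\zeta'$ iff for every $X_0a_1X_1\ldots X_n\in\zeta$ there is $Y_0a_1Y_1\ldots Y_n\in\zeta'$ with $X_i\supseteq Y_i$ for all $i\in 0..n-1$ and $X_n=Y_n$. - $\zeta\leq_I^{l\supseteq\vee f}\zeta'$ iff for every $X_0a_1X_1\ldots X_n\in\zeta$ there is a family $\{Y_0^ja_1Y_1^j\ldots Y_n^j\mid j\in J\}\subseteq\zeta'$ with $X_n=\bigcup_{j\in J}Y_n^j$.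
   Formalization: In the definition of ≤_I^{l⊇∨f} the family indexed by J is required to be nonempty; with J = ∅ allowed part 2 fails, e.g. for p without transitions and q with an a-transition (formula ⊤ ∧ ⋀_b ¬b⊤). -}

module Defs where

open import Level using (Level; Lift; lift) renaming (suc to lsuc)
open import Data.Bool.Base using (Bool; true; false)
open import Data.Empty.Polymorphic using (⊥)
open import Data.Fin.Base using (Fin; zero; suc; inject₁; fromℕ)
open import Data.Nat.Base using (suc)
open import Data.Product.Base using (∃-syntax; Σ-syntax; _×_)
open import Data.Vec.Functional using (Vector)
open import Relation.Binary.PropositionalEquality.Core using (_≡_)
open import Relation.Nullary.Negation.Core using (¬_)
open import Relation.Unary using (Pred; _∈_; _⊇_; _≐_; ⋃)

record LTS (ℓ : Level) : Set (lsuc ℓ) where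
  field
    Act    : Set ℓ
    Proc   : Set ℓ
    _—[_]→_ : Proc → Act → Proc → Set ℓ

-- Index sets of conjunctions and of families range over Set ℓ, the universe
-- that also contains the processes, the actions and the transitions.
module Semantics {ℓ : Level} (S : LTS ℓ) where
  open LTS S public

  I : Proc → Pred Act ℓ
  I p a = ∃[ p′ ] p —[ a ]→ p′

  infixr 8 ⟨_⟩_
  infix  8 ~_
  infixr 7 _∧_
  infix  4 _⊨_ _⊑[_]_

  data Formula : Set (lsuc ℓ) where
    ⋀    : (J : Set ℓ) → (J → Formula) → Formula
    ⟨_⟩_ : Act → Formula → Formula
    ~_   : Formula → Formula

  _⊨_ : Proc → Formula → Set ℓ
  p ⊨ ⋀ J φ   = ∀ (j : J) → p ⊨ φ j
  p ⊨ ⟨ a ⟩ φ = ∃[ q ] (p —[ a ]→ q × q ⊨ φ)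
  p ⊨ ~ φ     = ¬ (p ⊨ φ)

  ⊤ᶠ : Formula
  ⊤ᶠ = ⋀ ⊥ λ ()

  _∧_ : Formula → Formula → Formula
  φ ∧ ψ = ⋀ (Lift ℓ Bool) λ { (lift true) → φ ; (lift false) → ψ }

  𝟎 : Formula
  𝟎 = ⋀ Act λ a → ~ ⟨ a ⟩ ⊤ᶠ

  _⊑[_]_ : Proc → Pred Formula (lsuc ℓ) → Proc → Set (lsuc ℓ)
  p ⊑[ 𝓛 ] q = ∀ φ → φ ∈ 𝓛 → p ⊨ φ → q ⊨ φ

  data 𝓛′I : Pred Formula (lsuc ℓ) where
    top   : ⊤ᶠ ∈ 𝓛′I
    not-𝟎 : ~ 𝟎 ∈ 𝓛′I
    can   : ∀ a → ⟨ a ⟩ ⊤ᶠ ∈ 𝓛′I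

  data 𝓛I≡ : Pred Formula (lsuc ℓ) where
    pos  : ∀ {σ} → σ ∈ 𝓛′I → σ ∈ 𝓛I≡
    neg  : ∀ {σ} → σ ∈ 𝓛′I → ~ σ ∈ 𝓛I≡
    conj : ∀ (J : Set ℓ) {σ : J → Formula} → (∀ j → σ j ∈ 𝓛I≡) → ⋀ J σ ∈ 𝓛I≡

  data 𝓛I¬ : Pred Formula (lsuc ℓ) where
    neg  : ∀ {σ} → σ ∈ 𝓛′I → ~ σ ∈ 𝓛I¬
    conj : ∀ (J : Set ℓ) {σ : J → Formula} → (∀ j → σ j ∈ 𝓛I¬) → ⋀ J σ ∈ 𝓛I¬

  data 𝓛′⊇∧f : Pred Formula (lsuc ℓ) where
    top   : ⊤ᶠ ∈ 𝓛′⊇∧f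
    guard : ∀ {σ φ} → φ ∈ 𝓛′⊇∧f → σ ∈ 𝓛I¬ → σ ∧ φ ∈ 𝓛′⊇∧f
    final : ∀ {σ} → σ ∈ 𝓛I≡ → σ ∈ 𝓛′⊇∧f
    act   : ∀ {φ} a → φ ∈ 𝓛′⊇∧f → ⟨ a ⟩ φ ∈ 𝓛′⊇∧f

  data 𝓛′⊇∨f : Pred Formula (lsuc ℓ) where
    top   : ⊤ᶠ ∈ 𝓛′⊇∨f
    final : ∀ {σ} (J : Set ℓ) {τ : J → Formula} → σ ∈ 𝓛′I → (∀ j → τ j ∈ 𝓛′I) →
            σ ∧ ⋀ J (λ j → ~ τ j) ∈ 𝓛′⊇∨f
    act   : ∀ {φ} a → φ ∈ 𝓛′⊇∨f → ⟨ a ⟩ φ ∈ 𝓛′⊇∨f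

  -- Sets of sequences X₀ a₁ X₁ … aₙ Xₙ.  The actions are indexed from zero,
  -- so entry i of the action vector is aᵢ₊₁, lying between X (inject₁ i) and
  -- X (suc i); the last set Xₙ is X (fromℕ n).
  Observations : Set (lsuc ℓ)
  Observations = ∀ n → Vector Act n → Vector (Pred Act ℓ) (suc n) → Set ℓ

  -- Equality of subsets of Act is extensional equality _≐_.
  LGO : Proc → Observations
  LGO p n a X =
    Σ[ r ∈ Vector Proc (suc n) ]
      r zero ≡ p
      × (∀ (i : Fin n) → r (inject₁ i) —[ a i ]→ r (suc i))
      × (∀ (i : Fin (suc n)) → X i ≐ I (r i))

  infix 4 _≤⊇∧f_ _≤⊇∨f_

  _≤⊇∧f_ : Observations → Observations → Set (lsuc ℓ)
  ζ ≤⊇∧f ζ′ = ∀ n a X → ζ n a X →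
    ∃[ Y ] ζ′ n a Y
         × (∀ (i : Fin n) → X (inject₁ i) ⊇ Y (inject₁ i))
         × X (fromℕ n) ≐ Y (fromℕ n)

  -- The family is required to be nonempty (J is inhabited): an empty family
  -- would match every sequence with Xₙ = ∅, so that, for instance, a process
  -- without transitions would lie below every process.
  _≤⊇∨f_ : Observations → Observations → Set (lsuc ℓ)
  ζ ≤⊇∨f ζ′ = ∀ n a X → ζ n a X →
    Σ[ J ∈ Set ℓ ] J ×
    Σ[ Y ∈ (J → Vector (Pred Act ℓ) (suc n)) ]
      (∀ j → ζ′ n a (Y j))
      × X (fromℕ n) ≐ ⋃ J (λ j → Y j (fromℕ n))

{-# OPTIONS --safe #-}

-- From logic to observations, the observation X₀ a₁ X₁ … aₙ Xₙ of p is encoded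
-- by formulas that p satisfies.  For ⊇∧f a single formula suffices: it forbids
-- at each Xᵢ the actions outside Xᵢ and demands at Xₙ those in Xₙ.  In 𝓛′⊇∨f
-- only one action can be demanded at the end, so one formula is used per action
-- of Xₙ, and one more that demands nothing to keep the family nonempty.
-- Conversely, a formula satisfied by p yields an observation of p all of whose
-- matches satisfy the formula.

module Submission where

open import Axiom.ExcludedMiddle using (ExcludedMiddle)
open import Data.Bool.Base using (true; false)
open import Data.Empty using (⊥-elim)
open import Data.Fin.Base using (zero; suc; inject₁; fromℕ)
open import Data.Maybe.Base using (Maybe; just; nothing)
open import Data.Nat.Base using (zero; suc)
open import Data.Product.Base using (∃; ∃-syntax; _×_; _,_; proj₁; proj₂)
open import Data.Vec.Functional using (Vector; []; _∷_; tail)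
open import Function.Base using (_∘_)
open import Function.Bundles using (_⇔_; mk⇔)
open import Level using (Level; lift)
open import Relation.Binary.PropositionalEquality.Core using (refl)
open import Relation.Nullary.Decidable.Core using (yes; no; decidable-stable)
open import Relation.Unary using (Pred; _∈_; _∉_; _⊆_; _⊇_; _≐_; ⋃)
open import Relation.Unary.Properties using (≐-refl; ≐-sym; ≐-trans)
open import Defs using (LTS; module Semantics)

module _ {ℓ : Level} (em : ExcludedMiddle ℓ) (S : LTS ℓ) where
  open Semantics S

  LGO-[] : ∀ {p as} → LGO p 0 as (I p ∷ [])
  LGO-[] {p} = p ∷ [] , refl , (λ ()) , λ { zero → ≐-refl }

  LGO-∷ : ∀ {n p p′ as X} → p —[ as zero ]→ p′ → LGO p′ n (tail as) X →
          LGO p (suc n) as (I p ∷ X)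
  LGO-∷ {p = p} t (r , refl , ts , eqs) =
    p ∷ r , refl , (λ { zero → t ; (suc i) → ts i }) ,
    λ { zero → ≐-refl ; (suc i) → eqs i }

  LGO-head : ∀ {n p as X} → LGO p n as X → X zero ≐ I p
  LGO-head (_ , refl , _ , eqs) = eqs zero

  LGO-tail : ∀ {n p as X} → LGO p (suc n) as X →
             ∃[ p′ ] p —[ as zero ]→ p′ × LGO p′ n (tail as) (tail X)
  LGO-tail (r , refl , ts , eqs) =
    r (suc zero) , ts zero , tail r , refl , ts ∘ suc , eqs ∘ suc

  ⊨can : ∀ {p a} → a ∈ I p → p ⊨ ⟨ a ⟩ ⊤ᶠ
  ⊨can (p′ , t) = p′ , t , λ ()

  can⊨ : ∀ {p a} → p ⊨ ⟨ a ⟩ ⊤ᶠ → a ∈ I p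
  can⊨ (p′ , t , _) = p′ , t

  -- Each of these formulas is positive in the initial actions. Even `~ 𝟎` only says that some
  -- action is enabled.
  𝓛′I-mono : ∀ {p q σ} → σ ∈ 𝓛′I → I p ⊆ I q → p ⊨ σ → q ⊨ σ
  𝓛′I-mono top     _   _  = λ ()
  𝓛′I-mono not-𝟎   p⊆q ¬𝟎 = λ q⊨𝟎 → ¬𝟎 λ a → q⊨𝟎 a ∘ ⊨can ∘ p⊆q ∘ can⊨
  𝓛′I-mono (can a) p⊆q    = ⊨can ∘ p⊆q ∘ can⊨

  𝓛I¬-anti : ∀ {p q σ} → σ ∈ 𝓛I¬ → I q ⊆ I p → p ⊨ σ → q ⊨ σ
  𝓛I¬-anti (neg σ∈)    q⊆p p⊨ = p⊨ ∘ 𝓛′I-mono σ∈ q⊆p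
  𝓛I¬-anti (conj _ σ∈) q⊆p p⊨ = λ j → 𝓛I¬-anti (σ∈ j) q⊆p (p⊨ j)

  𝓛I≡-resp : ∀ {p q σ} → σ ∈ 𝓛I≡ → I p ≐ I q → p ⊨ σ → q ⊨ σ
  𝓛I≡-resp (pos σ∈)    (p⊆q , _) p⊨ = 𝓛′I-mono σ∈ p⊆q p⊨
  𝓛I≡-resp (neg σ∈)    (_ , q⊆p) p⊨ = p⊨ ∘ 𝓛′I-mono σ∈ q⊆p
  𝓛I≡-resp (conj _ σ∈) p≐q       p⊨ = λ j → 𝓛I≡-resp (σ∈ j) p≐q (p⊨ j)

  within : Pred Act ℓ → Formula
  within X = ⋀ (∃[ a ] a ∉ X) λ (a , _) → ~ ⟨ a ⟩ ⊤ᶠ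

  ⊨within : ∀ {p X} → I p ⊆ X → p ⊨ within X
  ⊨within p⊆X (a , a∉X) = a∉X ∘ p⊆X ∘ can⊨

  within⊨ : ∀ {p X} → p ⊨ within X → I p ⊆ X
  -- `within X` only refutes `a ∉ X`; excluded middle turns this into `a ∈ X`.
  within⊨ p⊨ {a} a∈p = decidable-stable em λ a∉X → p⊨ (a , a∉X) (⊨can a∈p)

  exactly : Pred Act ℓ → Formula
  exactly X = ⋀ (∃ X) (λ (a , _) → ⟨ a ⟩ ⊤ᶠ) ∧ within X

  exactly∈𝓛I≡ : ∀ X → exactly X ∈ 𝓛I≡
  exactly∈𝓛I≡ X = conj _ λ
    { (lift true)  → conj _ λ (a , _) → pos (can a)
    ; (lift false) → conj _ λ (a , _) → neg (can a) }

  ⊨exactly : ∀ {p X} → X ≐ I p → p ⊨ exactly X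
  ⊨exactly (X⊆p , p⊆X) (lift true)  = λ (a , a∈X) → ⊨can (X⊆p a∈X)
  ⊨exactly (X⊆p , p⊆X) (lift false) = ⊨within p⊆X

  exactly⊨ : ∀ {p X} → p ⊨ exactly X → X ≐ I p
  exactly⊨ p⊨ =
    (λ a∈X → can⊨ (p⊨ (lift true) (_ , a∈X))) , within⊨ (p⊨ (lift false))

  infix 4 _⊒_

  _⊒_ : ∀ {n} → Vector (Pred Act ℓ) (suc n) → Vector (Pred Act ℓ) (suc n) → Set ℓ
  _⊒_ {n} X Y = (∀ i → X (inject₁ i) ⊇ Y (inject₁ i)) × X (fromℕ n) ≐ Y (fromℕ n)

  -- For `n = 0` the first set is also the last one, so the inclusion comes from the equality.
  ⊒-head : ∀ {n} (X Y : Vector (Pred Act ℓ) (suc n)) → X ⊒ Y → X zero ⊇ Y zero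
  ⊒-head {zero}  X Y (_ , X≐Y) = proj₂ X≐Y
  ⊒-head {suc n} X Y (X⊇Y , _) = X⊇Y zero

  observe : ∀ {n} → Vector Act n → Vector (Pred Act ℓ) (suc n) → Formula
  observe {zero}  as X = exactly (X zero)
  observe {suc n} as X = within (X zero) ∧ ⟨ as zero ⟩ observe (tail as) (tail X)

  observe∈𝓛′⊇∧f : ∀ {n} (as : Vector Act n) X → observe as X ∈ 𝓛′⊇∧f
  observe∈𝓛′⊇∧f {zero}  as X = final (exactly∈𝓛I≡ (X zero))
  observe∈𝓛′⊇∧f {suc n} as X =
    guard (act (as zero) (observe∈𝓛′⊇∧f (tail as) (tail X)))
          (conj _ λ (a , _) → neg (can a))

  ⊨observe : ∀ {n p} {as : Vector Act n} {X} → LGO p n as X → p ⊨ observe as X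
  ⊨observe {zero}  o              = ⊨exactly (LGO-head o)
  ⊨observe {suc n} o (lift true)  = ⊨within (proj₂ (LGO-head o))
  ⊨observe {suc n} o (lift false) with LGO-tail o
  ... | p′ , t , o′ = p′ , t , ⊨observe o′

  -- `Y` records the initial actions along the run of `q` that witnesses the nested modalities.
  observe⊨ : ∀ {n q} {as : Vector Act n} {X} → q ⊨ observe as X →
             ∃[ Y ] LGO q n as Y × X ⊒ Y
  observe⊨ {zero}  {q} q⊨ = I q ∷ [] , LGO-[] , (λ ()) , exactly⊨ q⊨
  observe⊨ {suc n} {q} q⊨ with q⊨ (lift false)
  ... | q′ , t , q′⊨ with observe⊨ q′⊨
  ... | Y , o , X⊇Y , X≐Y =
    I q ∷ Y , LGO-∷ t o ,
    (λ { zero → within⊨ (q⊨ (lift true)) ; (suc i) → X⊇Y i }) , X≐Y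

  ⊑⇒≤⊇∧f : ∀ {p q} → p ⊑[ 𝓛′⊇∧f ] q → LGO p ≤⊇∧f LGO q
  ⊑⇒≤⊇∧f p⊑q n as X o =
    observe⊨ (p⊑q (observe as X) (observe∈𝓛′⊇∧f as X) (⊨observe o))

  -- The observation follows the transitions of `p` that witness the modalities of `φ`. It is fixed
  -- before `q`, so under a modality the induction hypothesis applies to the successor of `q` given
  -- by the match.
  ∧f-witness : ∀ {p φ} → φ ∈ 𝓛′⊇∧f → p ⊨ φ →
    ∃[ n ] ∃[ as ] ∃[ X ] LGO p n as X × (∀ q Y → LGO q n as Y → X ⊒ Y → q ⊨ φ)
  ∧f-witness {p} top _ = 0 , [] , I p ∷ [] , LGO-[] , λ _ _ _ _ ()
  ∧f-witness (guard φ∈ σ∈) p⊨ with ∧f-witness φ∈ (p⊨ (lift false))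
  -- The guard depends only on the initial actions, of which a matching `q` has no more than `p`, so
  -- the observation for the guarded formula is kept.
  ... | n , as , X , o , suffices = n , as , X , o , λ q Y o′ X⊒Y → λ
    { (lift true)  → 𝓛I¬-anti σ∈
        (proj₁ (LGO-head o) ∘ ⊒-head X Y X⊒Y ∘ proj₂ (LGO-head o′)) (p⊨ (lift true))
    ; (lift false) → suffices q Y o′ X⊒Y }
  ∧f-witness {p} (final σ∈) p⊨ = 0 , [] , I p ∷ [] , LGO-[] ,
    λ q Y o (_ , X≐Y) → 𝓛I≡-resp σ∈ (≐-trans X≐Y (LGO-head o)) p⊨
  ∧f-witness {p} (act a φ∈) (p′ , t , p′⊨) with ∧f-witness φ∈ p′⊨
  ... | n , as , X , o , suffices =
    suc n , a ∷ as , I p ∷ X , LGO-∷ t o , λ q Y o′ (X⊇Y , X≐Y) →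
      let q′ , t′ , o″ = LGO-tail o′
      in q′ , t′ , suffices q′ (tail Y) o″ (X⊇Y ∘ suc , X≐Y)

  ≤⊇∧f⇒⊑ : ∀ {p q} → LGO p ≤⊇∧f LGO q → p ⊑[ 𝓛′⊇∧f ] q
  ≤⊇∧f⇒⊑ p≤q φ φ∈ p⊨ with ∧f-witness φ∈ p⊨
  ... | n , as , X , o , suffices with p≤q n as X o
  ... | Y , o′ , X⊒Y = suffices _ Y o′ X⊒Y

  after : ∀ {n} → Vector Act n → Formula → Formula
  after {zero}  as φ = φ
  after {suc n} as φ = ⟨ as zero ⟩ after (tail as) φ

  after∈𝓛′⊇∨f : ∀ {n φ} (as : Vector Act n) → φ ∈ 𝓛′⊇∨f → after as φ ∈ 𝓛′⊇∨f
  after∈𝓛′⊇∨f {zero}  as φ∈ = φ∈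
  after∈𝓛′⊇∨f {suc n} as φ∈ = act (as zero) (after∈𝓛′⊇∨f (tail as) φ∈)

  -- The formulas placed at the end depend only on initial actions, so `end` may range over all
  -- processes with the last set of `X`.
  ⊨after : ∀ {n p φ} {as : Vector Act n} {X} → LGO p n as X →
           (∀ r → X (fromℕ n) ≐ I r → r ⊨ φ) → p ⊨ after as φ
  ⊨after {zero}  {p} o end = end p (LGO-head o)
  ⊨after {suc n}     o end with LGO-tail o
  ... | p′ , t , o′ = p′ , t , ⊨after o′ end

  after⊨ : ∀ {n q φ} {as : Vector Act n} → q ⊨ after as φ →
           ∃[ Y ] LGO q n as Y × ∃[ r ] Y (fromℕ n) ≐ I r × r ⊨ φ
  after⊨ {zero}  {q} q⊨ = I q ∷ [] , LGO-[] , q , ≐-refl , q⊨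
  after⊨ {suc n} {q} (q′ , t , q′⊨) with after⊨ q′⊨
  ... | Y , o , end = I q ∷ Y , LGO-∷ t o , end

  -- The formula carried over to `q` ends in `σ` and the negation of every action outside the last
  -- set. The negations keep each member of the family from overshooting that set.
  ⊑⇒end-within : ∀ {n p q as X σ} → p ⊑[ 𝓛′⊇∨f ] q → LGO p n as X → σ ∈ 𝓛′I →
    (∀ r → X (fromℕ n) ≐ I r → r ⊨ σ) →
    ∃[ Y ] LGO q n as Y × Y (fromℕ n) ⊆ X (fromℕ n) ×
      ∃[ r ] Y (fromℕ n) ≐ I r × r ⊨ σ
  ⊑⇒end-within {n} {as = as} {X} p⊑q o σ∈ end
    with after⊨ (p⊑q _
           (after∈𝓛′⊇∨f as (final (∃[ a ] a ∉ X (fromℕ n)) σ∈ λ (a , _) → can a))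
           (⊨after o λ r X≐r → λ
             { (lift true) → end r X≐r ; (lift false) → ⊨within (proj₂ X≐r) }))
  ... | Y , o′ , r , Y≐r , r⊨ =
    Y , o′ , within⊨ (r⊨ (lift false)) ∘ proj₁ Y≐r , r , Y≐r , r⊨ (lift true)

  ⊑⇒≤⊇∨f : ∀ {p q} → p ⊑[ 𝓛′⊇∨f ] q → LGO p ≤⊇∨f LGO q
  ⊑⇒≤⊇∨f {p} {q} p⊑q n as X o =
    Maybe (∃ (X (fromℕ n))) , nothing ,
    (λ j → proj₁ (member j)) , (λ j → proj₁ (proj₂ (member j))) ,
    (λ a∈X → just (_ , a∈X) , covers a∈X) ,
    λ (j , a∈Y) → proj₁ (proj₂ (proj₂ (member j))) a∈Y
    where
    demand : Maybe (∃ (X (fromℕ n))) → Formula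
    demand nothing        = ⊤ᶠ
    demand (just (a , _)) = ⟨ a ⟩ ⊤ᶠ

    member : ∀ j → ∃[ Y ] LGO q n as Y × Y (fromℕ n) ⊆ X (fromℕ n) ×
                     ∃[ r ] Y (fromℕ n) ≐ I r × r ⊨ demand j
    member nothing          = ⊑⇒end-within p⊑q o top λ _ _ ()
    member (just (a , a∈X)) =
      ⊑⇒end-within p⊑q o (can a) λ r X≐r → ⊨can (proj₁ X≐r a∈X)

    covers : ∀ {a} (a∈X : a ∈ X (fromℕ n)) →
             a ∈ proj₁ (member (just (a , a∈X))) (fromℕ n)
    covers a∈X =
      let _ , _ , _ , r , Y≐r , r⊨ = member (just (_ , a∈X))
      in proj₂ Y≐r (can⊨ r⊨)

  -- At most one enabled action decides `σ`, and it already lies in a single member of the union.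
  -- For `top` the given member is taken.
  some-member⊨ : ∀ {p σ} {J : Set ℓ} {Z : J → Pred Act ℓ} → σ ∈ 𝓛′I → p ⊨ σ →
    J → I p ⊆ ⋃ J Z → ∃[ j ] (∀ q → Z j ⊆ I q → q ⊨ σ)
  some-member⊨ top _ j₀ _ = j₀ , λ _ _ ()
  -- `~ 𝟎` only refutes emptiness of `I p`; excluded middle supplies an actual action.
  some-member⊨ {p} not-𝟎 ¬𝟎 _ p⊆⋃ with em {∃ (I p)}
  ... | no ∄a         = ⊥-elim (¬𝟎 λ a p⊨a → ∄a (a , can⊨ p⊨a))
  ... | yes (a , a∈p) =
    let j , a∈Z = p⊆⋃ a∈p in j , λ q Z⊆q q⊨𝟎 → q⊨𝟎 a (⊨can (Z⊆q a∈Z))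
  some-member⊨ (can a) p⊨a _ p⊆⋃ =
    let j , a∈Z = p⊆⋃ (can⊨ p⊨a) in j , λ q Z⊆q → ⊨can (Z⊆q a∈Z)

  -- The member j must be chosen from the final sets Z alone, before any process
  -- q is fixed: under ⟨ a ⟩ the members of a family may start with different
  -- a-transitions, so the family itself does not pass to a successor of q.
  ∨f-witness : ∀ {p φ} → φ ∈ 𝓛′⊇∨f → p ⊨ φ →
    ∃[ n ] ∃[ as ] ∃[ X ] LGO p n as X ×
      (∀ {J : Set ℓ} {Z : J → Pred Act ℓ} → J → X (fromℕ n) ≐ ⋃ J Z →
        ∃[ j ] (∀ q Y → LGO q n as Y → Y (fromℕ n) ≐ Z j → q ⊨ φ))
  ∨f-witness {p} top _ = 0 , [] , I p ∷ [] , LGO-[] , λ j₀ _ → j₀ , λ _ _ _ _ ()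
  ∨f-witness {p} (final K σ∈ τ∈) p⊨ = 0 , [] , I p ∷ [] , LGO-[] , λ j₀ (p⊆⋃ , ⋃⊆p) →
    let j , suffices = some-member⊨ σ∈ (p⊨ (lift true)) j₀ p⊆⋃
    in j , λ q Y o Y≐Z →
      let q⊆Z , Z⊆q = ≐-trans (≐-sym (LGO-head o)) Y≐Z in λ
      { (lift true)  → suffices q Z⊆q
      -- Each member lies inside the union, hence `I q ⊆ I p`, and the negations pass from `p` to
      -- `q`.
      ; (lift false) → λ k →
          p⊨ (lift false) k ∘ 𝓛′I-mono (τ∈ k) (λ a∈q → ⋃⊆p (j , q⊆Z a∈q)) }
  ∨f-witness {p} (act a φ∈) (p′ , t , p′⊨) with ∨f-witness φ∈ p′⊨
  ... | n , as , X , o , choose =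
    suc n , a ∷ as , I p ∷ X , LGO-∷ t o , λ j₀ X≐⋃ →
      let j , suffices = choose j₀ X≐⋃
      in j , λ q Y o′ Y≐Z →
        let q′ , t′ , o″ = LGO-tail o′
        in q′ , t′ , suffices q′ (tail Y) o″ Y≐Z

  ≤⊇∨f⇒⊑ : ∀ {p q} → LGO p ≤⊇∨f LGO q → p ⊑[ 𝓛′⊇∨f ] q
  ≤⊇∨f⇒⊑ p≤q φ φ∈ p⊨ with ∨f-witness φ∈ p⊨
  ... | n , as , X , o , choose with p≤q n as X o
  ... | J , j₀ , Y , os , X≐⋃ with choose j₀ X≐⋃
  ... | j , suffices = suffices _ (Y j) (os j) ≐-refl

theorem8 : ∀ {ℓ : Level} → ExcludedMiddle ℓ → (S : LTS ℓ) → let open Semantics S in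
    (p q : Proc) →
    ((p ⊑[ 𝓛′⊇∧f ] q) ⇔ (LGO p ≤⊇∧f LGO q)) ×
    ((p ⊑[ 𝓛′⊇∨f ] q) ⇔ (LGO p ≤⊇∨f LGO q))
theorem8 em S p q =
  mk⇔ (⊑⇒≤⊇∧f em S) (≤⊇∧f⇒⊑ em S) , mk⇔ (⊑⇒≤⊇∨f em S) (≤⊇∨f⇒⊑ em S)
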